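{- Suppose that $\mu>\lambda\ge\theta>\kappa$ are infinite cardinals, and suppose that there is a family $\mathcal{P}$ of $\mu$ elements of $[\lambda]^{\le\kappa}$ such that every subfamily of $\mathcal{P}$ of size $<\theta$ has a transversal. Then there is such a family $\mathcal{P}$ (that is, a family of $\mu$ elements of $[\lambda]^{\le\kappa}$ every subfamily of which of size $<\theta$ has a transversal) such that in addition, every subfamily of $\mathcal{P}$ whose size $\sigma$ satisfies $\sigma<\theta$ and $\operatorname{cf}(\sigma)>\kappa$ has a subfamily of size $\operatorname{cf}(\sigma)$ that has a discretisation.
   Context: A transversal of a family of sets is a one-to-one choice function on it. A discretisation of a non-empty family $\mathcal{F}$ of non-empty sets is a choice function $f$ on $\mathcal{F}$ (i.e. $f(F)\in F$ for all $F\in\mathcal{F}$) such that for all $F_0\ne F_1$ in $\mathcal{F}$, $f(F_0)\notin F_1$. $[\lambda]^{\le\kappa}$ denotes the set of subsets of $\lambda$ of cardinality at most $\kappa$. -}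

module Defs where

open import Data.Nat.Base using (ℕ)
open import Data.Product.Base using (Σ; ∃; _×_; proj₁)
open import Data.Sum.Base using (_⊎_)
open import Function.Bundles using (Injection; Bijection)
open import Induction.WellFounded using (WellFounded)
open import Level using (0ℓ)
open import Relation.Binary.Bundles using (Setoid)
open import Relation.Binary.Core using (Rel)
open import Relation.Binary.Structures using (IsStrictTotalOrder)
open import Relation.Binary.PropositionalEquality using (_≡_; _≢_; setoid)
import Relation.Binary.Construct.On as On
open import Relation.Nullary.Negation using (¬_)
open import Relation.Unary using (Pred; _∈_; _∉_; _⊆_; _≐_; Satisfiable)

infix 4 _≼_ _≺_ _≈_

-- Sets are types in Set, and subsets of A are predicates Pred A 0ℓ, compared
-- by _≐_.  Cardinality is compared through setoids, so that a subset can be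
-- measured without counting the different proofs of membership.

Sets : Set₁
Sets = Setoid 0ℓ 0ℓ

_≼_ _≺_ _≈_ : Sets → Sets → Set
A ≼ B = Injection A B
A ≺ B = A ≼ B × ¬ (B ≼ A)
A ≈ B = Bijection A B

⟪_⟫ : {A : Set} → Pred A 0ℓ → Sets
⟪_⟫ {A} P = On.setoid {B = Σ A P} (setoid A) proj₁

-- A cardinal is an initial ordinal: a well-ordered type that does not inject
-- into any of its proper initial segments.

record Cardinal : Set₁ where
  field
    Carrier            : Set
    _<_                : Rel Carrier 0ℓ
    isStrictTotalOrder : IsStrictTotalOrder _≡_ _<_
    wellFounded        : WellFounded _<_
    initial            : ∀ x → ¬ (setoid Carrier ≼ ⟪ (λ y → y < x) ⟫)

  _≤_ : Rel Carrier 0ℓ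
  x ≤ y = x < y ⊎ x ≡ y

open Cardinal public using (Carrier)

∣_∣ : Cardinal → Sets
∣ κ ∣ = setoid (Carrier κ)

Infinite : Cardinal → Set
Infinite κ = setoid ℕ ≼ ∣ κ ∣

Cofinal : (σ : Cardinal) → Pred (Carrier σ) 0ℓ → Set
Cofinal σ C = ∀ x → ∃ λ c → c ∈ C × x ≤ c
  where open Cardinal σ using (_≤_)

-- γ = cf(σ): the least cardinality of a cofinal subset of σ.

_IsCofinalityOf_ : Cardinal → Cardinal → Set₁
γ IsCofinalityOf σ =
    (∃ λ (C : Pred (Carrier σ) 0ℓ) → Cofinal σ C × ⟪ C ⟫ ≈ ∣ γ ∣)
  × (∀ (C : Pred (Carrier σ) 0ℓ) → Cofinal σ C → ∣ γ ∣ ≼ ⟪ C ⟫)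

-- A set of subsets of A, presented by a repetition-free indexing.  Hence the
-- family has the cardinality of I, and its subfamilies correspond to the
-- subsets of I, with the same cardinality.

record Family (I A : Set) : Set₁ where
  field
    member   : I → Pred A 0ℓ
    distinct : ∀ {i j} → member i ≐ member j → i ≡ j

open Family public using (member)

module _ {I A : Set} (𝓕 : Family I A) where

  -- Choice functions on the subfamily Q are total functions I → A of which
  -- only the values on Q matter; this loses nothing when A is inhabited.

  IsChoiceOn : Pred I 0ℓ → (I → A) → Set
  IsChoiceOn Q f = ∀ {i} → i ∈ Q → f i ∈ member 𝓕 i

  IsTransversal : Pred I 0ℓ → (I → A) → Set
  IsTransversal Q f =
    IsChoiceOn Q f × (∀ {i j} → i ∈ Q → j ∈ Q → f i ≡ f j → i ≡ j)

  IsDiscretisation : Pred I 0ℓ → (I → A) → Set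
  IsDiscretisation Q f =
    IsChoiceOn Q f × (∀ {i j} → i ∈ Q → j ∈ Q → i ≢ j → f i ∉ member 𝓕 j)

  HasTransversal : Pred I 0ℓ → Set
  HasTransversal Q = ∃ λ f → IsTransversal Q f

  -- The members of Q are non-empty as soon as a choice function exists.

  HasDiscretisation : Pred I 0ℓ → Set
  HasDiscretisation Q = Satisfiable Q × ∃ λ f → IsDiscretisation Q f

-- 𝓟 ⊆ [A]^{≤κ}, and every subfamily of size < θ has a transversal.

IsTransversalFamily : {I A : Set} (θ κ : Cardinal) → Family I A → Set₁
IsTransversalFamily {I} θ κ 𝓟 =
    (∀ i → ⟪ member 𝓟 i ⟫ ≼ ∣ κ ∣)
  × (∀ (Q : Pred I 0ℓ) → ⟪ Q ⟫ ≺ ∣ θ ∣ → HasTransversal 𝓟 Q)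

-- Every subfamily of size σ, where σ < θ and cf(σ) > κ, has a subfamily of
-- size cf(σ) that has a discretisation.

HasDiscretisableSubfamilies : {I A : Set} (θ κ : Cardinal) → Family I A → Set₁
HasDiscretisableSubfamilies {I} θ κ 𝓟 =
  ∀ (σ cfσ : Cardinal) → cfσ IsCofinalityOf σ →
  ∣ σ ∣ ≺ ∣ θ ∣ → ∣ κ ∣ ≺ ∣ cfσ ∣ →
  ∀ (Q : Pred I 0ℓ) → ⟪ Q ⟫ ≈ ∣ σ ∣ →
  ∃ λ (R : Pred I 0ℓ) →
    R ⊆ Q × ⟪ R ⟫ ≈ ∣ cfσ ∣ × HasDiscretisation 𝓟 R

{-# OPTIONS --safe #-}
-- Fix injections e i from each set P i into κ and an injection π of κ × Λ into
-- Λ (by Hessenberg's theorem), and replace P i by { π (e i x , x) ∣ x ∈ P i },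
-- that is, by a copy of the graph of e i.  A transversal f of a subfamily Q gives the transversal
-- i ↦ π (e i (f i) , f i), and it is a discretisation of any R ⊆ Q on which the
-- colour e i (f i) is constant, because each e i is injective.  If Q has size σ
-- and κ < cf σ, then some colour class is cofinal in σ: otherwise bounds of the
-- classes would form a cofinal set of size at most κ.  This class contains a
-- set R of size cf σ.
module Submission where

open import Defs
open import Axiom.ExcludedMiddle using (ExcludedMiddle)
open import Axiom.Extensionality.Propositional using (Extensionality; implicit-extensionality)
open import Data.Fin.Base using (Fin; toℕ; fromℕ<; combine)
open import Data.Fin.Properties using (combine-injective; fromℕ<-injective; injective⇒≤; toℕ-injective)
import Data.Nat.Base as ℕ
open import Data.Nat.Base using (ℕ)
import Data.Nat.Induction as ℕ
import Data.Nat.Properties as ℕ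
open import Data.Product.Base using (Σ; ∃; _×_; _,_; proj₁; proj₂; map)
open import Data.Product.Relation.Binary.Lex.Strict using (×-Lex; ×-isStrictTotalOrder; ×-wellFounded)
open import Data.Sum.Base using (_⊎_; inj₁; inj₂)
open import Data.Unit.Base using (tt)
open import Function.Base using (_∘_; id; _on_)
open import Function.Bundles using (Injection; Bijection)
import Function.Construct.Composition as Compose
import Function.Construct.Symmetry as Symmetry
open import Induction.WellFounded using (WellFounded; WfRec; module All; module FixPoint)
open import Level using (0ℓ)
import Relation.Binary.Construct.On as On
open import Relation.Binary.Core using (Rel)
open import Relation.Binary.Definitions using (Tri; tri<; tri≈; tri>)
open import Relation.Binary.PropositionalEquality
  using (_≡_; _≢_; refl; sym; trans; cong; cong₂; subst; setoid; isEquivalence)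
open import Relation.Binary.Structures using (IsStrictTotalOrder)
open import Relation.Nullary.Decidable.Core using (yes; no)
open import Relation.Nullary.Negation.Core using (¬_; contradiction)
open import Relation.Unary using (Pred; _∈_; _⊆_; _∩_; _⟨×⟩_; U; Satisfiable)

-- Injections between subsets

infix 4 _↪_

-- The map is total on the ambient type, so that no proofs of membership occur.
record _↪_ {A B : Set} (P : Pred A 0ℓ) (Q : Pred B 0ℓ) : Set where
  field
    to        : A → B
    maps      : ∀ a → a ∈ P → to a ∈ Q
    injective : ∀ {a a′} → a ∈ P → a′ ∈ P → to a ≡ to a′ → a ≡ a′

open _↪_

module _ {A : Set} {P Q : Pred A 0ℓ} where

  ⊆⇒↪ : P ⊆ Q → P ↪ Q
  ⊆⇒↪ P⊆Q = record { to = id ; maps = λ _ → P⊆Q ; injective = λ _ _ → id }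

module _ {A B : Set} {P : Pred A 0ℓ} {Q : Pred B 0ℓ} where
  infixr 9 _⨾_
  infixr 10 _⊗_

  _⨾_ : ∀ {C : Set} {R : Pred C 0ℓ} → P ↪ Q → Q ↪ R → P ↪ R
  f ⨾ g = record
    { to        = to g ∘ to f
    ; maps      = λ a → maps g (to f a) ∘ maps f a
    ; injective = λ {a} {a′} p p′ → injective f p p′ ∘ injective g (maps f a p) (maps f a′ p′)
    }

  _⊗_ : ∀ {C D : Set} {R : Pred C 0ℓ} {S : Pred D 0ℓ} → P ↪ Q → R ↪ S → (P ⟨×⟩ R) ↪ (Q ⟨×⟩ S)
  f ⊗ g = record
    { to        = map (to f) (to g)
    ; maps      = λ (a , c) → map (maps f a) (maps g c)
    ; injective = λ (p , r) (p′ , r′) e →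
        cong₂ _,_ (injective f p p′ (cong proj₁ e)) (injective g r r′ (cong proj₂ e))
    }

-- Infinite subsets and finite squares

InfiniteSet : {A : Set} → Pred A 0ℓ → Set
InfiniteSet P = U {A = ℕ} ↪ P

-- Pigeonhole: the first `n * n + 1` values would be distinct pairs, and `combine` codes these pairs
-- in `Fin (n * n)`.
¬InfiniteSet-square : ∀ n → ¬ InfiniteSet ((ℕ._< n) ⟨×⟩ (ℕ._< n))
¬InfiniteSet-square n f = ℕ.<-irrefl refl (injective⇒≤ {f = g} g-injective)
  where
  bounded : ∀ k → to f k ∈ ((ℕ._< n) ⟨×⟩ (ℕ._< n))
  bounded k = maps f k tt

  g₁ g₂ : Fin (ℕ.suc (n ℕ.* n)) → Fin n
  g₁ k = fromℕ< (proj₁ (bounded (toℕ k)))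
  g₂ k = fromℕ< (proj₂ (bounded (toℕ k)))

  g : Fin (ℕ.suc (n ℕ.* n)) → Fin (n ℕ.* n)
  g k = combine (g₁ k) (g₂ k)

  g-injective : ∀ {k l} → g k ≡ g l → k ≡ l
  g-injective {k} {l} e with combine-injective (g₁ k) (g₂ k) (g₁ l) (g₂ l) e
  ... | e₁ , e₂ = toℕ-injective (injective f tt tt
    (cong₂ _,_ (fromℕ<-injective _ _ _ _ e₁) (fromℕ<-injective _ _ _ _ e₂)))

-- Well-orders and the ordering of pairs

module WellOrder {A : Set} {_<_ : Rel A 0ℓ}
  (sto : IsStrictTotalOrder _≡_ _<_) (wf : WellFounded _<_)
  where
  open IsStrictTotalOrder sto using (compare) renaming (trans to <-trans)

  _≤_ : Rel A 0ℓ
  x ≤ y = x < y ⊎ x ≡ y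

  ≤-<-trans : ∀ {x y z} → x ≤ y → y < z → x < z
  ≤-<-trans (inj₁ x<y)  = <-trans x<y
  ≤-<-trans (inj₂ refl) = id

  ≤-trans : ∀ {x y z} → x ≤ y → y ≤ z → x ≤ z
  ≤-trans x≤y (inj₁ y<z)  = inj₁ (≤-<-trans x≤y y<z)
  ≤-trans x≤y (inj₂ refl) = x≤y

  ≰⇒> : ∀ {x y} → ¬ (x ≤ y) → y < x
  ≰⇒> {x} {y} x≰y with compare x y
  ... | tri< x<y _ _ = contradiction (inj₁ x<y) x≰y
  ... | tri≈ _ x≡y _ = contradiction (inj₂ x≡y) x≰y
  ... | tri> _ _ y<x = y<x

  max : A × A → A
  max (x , y) with compare x y
  ... | tri< _ _ _ = y
  ... | tri≈ _ _ _ = y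
  ... | tri> _ _ _ = x

  max-upper : ∀ p → proj₁ p ≤ max p × proj₂ p ≤ max p
  max-upper (x , y) with compare x y
  ... | tri< x<y _ _ = inj₁ x<y , inj₂ refl
  ... | tri≈ _ x≡y _ = inj₂ x≡y , inj₂ refl
  ... | tri> _ _ y<x = inj₂ refl , inj₁ y<x

  max-∈ : ∀ {D : Pred A 0ℓ} {p} → p ∈ (D ⟨×⟩ D) → max p ∈ D
  max-∈ {p = x , y} (x∈D , y∈D) with compare x y
  ... | tri< _ _ _ = y∈D
  ... | tri≈ _ _ _ = y∈D
  ... | tri> _ _ _ = x∈D

  -- Gödel's well-ordering of A × A.
  key : A × A → A × A × A
  key p = max p , p

  _◁_ : Rel (A × A) 0ℓ
  _◁_ = ×-Lex _≡_ _<_ (×-Lex _≡_ _<_ _<_) on key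

  ◁-isStrictTotalOrder : IsStrictTotalOrder _≡_ _◁_
  ◁-isStrictTotalOrder = record
    { isStrictPartialOrder = record
      { isEquivalence = isEquivalence
      ; irrefl        = λ { refl → G.irrefl (refl , refl , refl) }
      ; trans         = λ {p} {q} {r} → G.trans {key p} {key q} {key r}
      ; <-resp-≈      = (λ { refl → id }) , λ { refl → id }
      }
    ; compare = compare◁
    }
    where
    module G = IsStrictTotalOrder (×-isStrictTotalOrder sto (×-isStrictTotalOrder sto sto))

    compare◁ : ∀ p q → Tri (p ◁ q) (p ≡ q) (q ◁ p)
    compare◁ p q with G.compare (key p) (key q)
    ... | tri< a ¬b ¬c = tri< a (λ { refl → ¬b (refl , refl , refl) }) ¬c
    ... | tri≈ ¬a b ¬c = tri≈ ¬a (cong₂ _,_ (proj₁ (proj₂ b)) (proj₂ (proj₂ b))) ¬c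
    ... | tri> ¬a ¬b c = tri> ¬a (λ { refl → ¬b (refl , refl , refl) }) c

  ◁-wellFounded : WellFounded _◁_
  ◁-wellFounded = On.wellFounded key (×-wellFounded wf (×-wellFounded wf wf))

  -- The maximum is the first entry of `key`, so it is compared first.
  ◁⇒≤max : ∀ {p q} → p ◁ q → p ∈ ((_≤ max q) ⟨×⟩ (_≤ max q))
  ◁⇒≤max {p} {q} p◁q =
    map (λ x≤ → ≤-trans x≤ (max≤ p◁q)) (λ y≤ → ≤-trans y≤ (max≤ p◁q)) (max-upper p)
    where
    max≤ : p ◁ q → max p ≤ max q
    max≤ (inj₁ m<m)      = inj₁ m<m
    max≤ (inj₂ (m≡m , _)) = inj₂ m≡m

-- Choice and greedy injections

module _ (lem : ExcludedMiddle 0ℓ) where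

  -- Excluded middle for types, not only for propositions, acts as a choice operator.
  choose : {B : Set} → B → Pred B 0ℓ → B
  choose b₀ S with lem {Satisfiable S}
  ... | yes (b , _) = b
  ... | no  _       = b₀

  choose-∈ : ∀ {B : Set} b₀ {S : Pred B 0ℓ} → Satisfiable S → choose b₀ S ∈ S
  choose-∈ b₀ {S} s with lem {Satisfiable S}
  ... | yes (_ , b∈S) = b∈S
  ... | no  ¬s        = contradiction s ¬s

  byContradiction : {P : Set} → ¬ ¬ P → P
  byContradiction {P} ¬¬p with lem {P}
  ... | yes p = p
  ... | no ¬p = contradiction ¬p ¬¬p

  module _ (ext : Extensionality 0ℓ 0ℓ) where

    -- Map each w to an element of Q not used below w; if there were none, Q would
    -- embed into the elements below w.
    greedy : ∀ {W B : Set} {_<_ : Rel W 0ℓ} → IsStrictTotalOrder _≡_ _<_ → WellFounded _<_ →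
             {P : Pred W 0ℓ} {Q : Pred B 0ℓ} → B →
             (∀ {w} → w ∈ P → ¬ Q ↪ (P ∩ (_< w))) → P ↪ Q
    greedy {W} {B} {_<_} sto wf {P} {Q} b₀ small = record
      { to        = g
      ; maps      = λ w w∈P → proj₁ (g-fresh w∈P)
      ; injective = g-injective
      }
      where
      open IsStrictTotalOrder sto using (compare)

      Fresh : ∀ w → WfRec _<_ (λ _ → B) w → Pred B 0ℓ
      Fresh w h b = b ∈ Q × (∀ {v} (v<w : v < w) → v ∈ P → h v<w ≢ b)

      step : ∀ w → WfRec _<_ (λ _ → B) w → B
      -- The default `b₀` is never taken for `w ∈ P`, where `fresh` supplies a candidate.
      step w h = choose b₀ (Fresh w h)

      -- Needed to unfold the recursion: extensionality identifies histories that agree pointwise.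
      step-ext : ∀ w {h k : WfRec _<_ (λ _ → B) w} →
                 (∀ {v} (v<w : v < w) → h v<w ≡ k v<w) → step w h ≡ step w k
      step-ext w h≡k =
        cong (λ (h : WfRec _<_ (λ _ → B) w) → step w h)
             (implicit-extensionality ext (ext h≡k))

      g : W → B
      g = All.wfRec wf 0ℓ (λ _ → B) step

      fresh : ∀ {w} → w ∈ P → Satisfiable (Fresh w (λ {v} _ → g v))
      fresh {w} w∈P = byContradiction λ none →
        let
          used : ∀ b → b ∈ Q → ∃ λ v → (v ∈ P × v < w) × g v ≡ b
          used b b∈Q = byContradiction λ unused →
            none (b , b∈Q , λ {v} v<w v∈P e → unused (v , (v∈P , v<w) , e))
          source : B → Pred W 0ℓ
          source b v = (v ∈ P × v < w) × g v ≡ b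
          source-∈ : ∀ b → b ∈ Q → choose w (source b) ∈ source b
          source-∈ b b∈Q = choose-∈ w (used b b∈Q)
        in small w∈P record
          { to        = λ b → choose w (source b)
          ; maps      = λ b b∈Q → proj₁ (source-∈ b b∈Q)
          -- Applying `g` to the chosen source of `b` gives back `b`.
          ; injective = λ {b} {b′} b∈Q b′∈Q e →
              trans (sym (proj₂ (source-∈ b b∈Q)))
                    (trans (cong g e) (proj₂ (source-∈ b′ b′∈Q)))
          }

      g-fresh : ∀ {w} → w ∈ P → g w ∈ Fresh w (λ {v} _ → g v)
      g-fresh {w} w∈P =
        subst (_∈ Fresh w (λ {v} _ → g v))
              (sym (FixPoint.unfold-wfRec wf (λ _ → B) step step-ext {w}))
              (choose-∈ b₀ (fresh w∈P))

      g-injective : ∀ {v w} → v ∈ P → w ∈ P → g v ≡ g w → v ≡ w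
      g-injective {v} {w} v∈P w∈P e with compare v w
      ... | tri< v<w _ _ = contradiction e (proj₂ (g-fresh w∈P) v<w v∈P)
      ... | tri≈ _ v≡w _ = v≡w
      ... | tri> _ _ w<v = contradiction (sym e) (proj₂ (g-fresh v∈P) w<v w∈P)

    -- If `P` embedded in no initial segment of ℕ, the greedy construction would embed ℕ into `P`.
    ¬InfiniteSet⇒bounded : ∀ {A : Set} {P : Pred A 0ℓ} → A → ¬ InfiniteSet P →
                           ∃ λ n → P ↪ (ℕ._< n)
    ¬InfiniteSet⇒bounded a fin = byContradiction λ unbounded →
      fin (greedy ℕ.<-isStrictTotalOrder ℕ.<-wellFounded a
        λ {n} _ P↪ → unbounded (n , P↪ ⨾ ⊆⇒↪ proj₂))

    -- Hessenberg's theorem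

    module _ {A : Set} {_<_ : Rel A 0ℓ}
             (sto : IsStrictTotalOrder _≡_ _<_) (wf : WellFounded _<_) where
      open IsStrictTotalOrder sto using () renaming (trans to <-trans)
      open WellOrder sto wf

      -- Two distinct elements of an infinite set suffice to make room for m in its square.
      ≤↪<-square : ∀ m → InfiniteSet (_< m) → (_≤ m) ↪ ((_< m) ⟨×⟩ (_< m))
      ≤↪<-square m f = record { to = h ; maps = h-maps ; injective = h-injective }
        where
        z₀ z₁ : A
        z₀ = to f 0
        z₁ = to f 1

        z₀≢z₁ : z₀ ≢ z₁
        z₀≢z₁ e with () ← injective f {0} {1} tt tt e

        h : A → A × A
        h y with lem {y ≡ m}
        ... | yes _ = z₀ , z₁
        ... | no  _ = y , z₀

        h-maps : ∀ y → y ≤ m → h y ∈ ((_< m) ⟨×⟩ (_< m))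
        h-maps y y≤m with lem {y ≡ m}
        h-maps y y≤m         | yes _   = maps f 0 tt , maps f 1 tt
        h-maps y (inj₁ y<m)  | no  _   = y<m , maps f 0 tt
        h-maps y (inj₂ y≡m)  | no  y≢m = contradiction y≡m y≢m

        h-injective : ∀ {y y′} → y ≤ m → y′ ≤ m → h y ≡ h y′ → y ≡ y′
        h-injective {y} {y′} _ _ e with lem {y ≡ m} | lem {y′ ≡ m}
        ... | yes y≡m | yes y′≡m = trans y≡m (sym y′≡m)
        ... | yes _   | no  _    = contradiction (sym (cong proj₂ e)) z₀≢z₁
        ... | no  _   | yes _    = contradiction (cong proj₂ e) z₀≢z₁
        ... | no  _   | no  _    = cong proj₁ e

      -- The point `m` takes the value `n`, which exceeds every value of `f` below `m`.
      ≤↪suc : ∀ {m n} → (_< m) ↪ (ℕ._< n) → (_≤ m) ↪ (ℕ._< ℕ.suc n)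
      ≤↪suc {m} {n} f = record { to = h ; maps = h-maps ; injective = h-injective }
        where
        h : A → ℕ
        h y with lem {y ≡ m}
        ... | yes _ = n
        ... | no  _ = to f y

        below : ∀ {y} → y ≤ m → y ≢ m → y < m
        below (inj₁ y<m) _   = y<m
        below (inj₂ y≡m) y≢m = contradiction y≡m y≢m

        h-maps : ∀ y → y ≤ m → h y ℕ.< ℕ.suc n
        h-maps y y≤m with lem {y ≡ m}
        ... | yes _   = ℕ.n<1+n n
        ... | no  y≢m = ℕ.m<n⇒m<1+n (maps f y (below y≤m y≢m))

        h-injective : ∀ {y y′} → y ≤ m → y′ ≤ m → h y ≡ h y′ → y ≡ y′
        h-injective {y} {y′} y≤m y′≤m e with lem {y ≡ m} | lem {y′ ≡ m}
        ... | yes y≡m | yes y′≡m = trans y≡m (sym y′≡m)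
        ... | yes _   | no  y′≢m =
          contradiction (maps f y′ (below y′≤m y′≢m)) (ℕ.<-irrefl (sym e))
        ... | no  y≢m | yes _    =
          contradiction (maps f y (below y≤m y≢m)) (ℕ.<-irrefl e)
        ... | no  y≢m | no  y′≢m = injective f (below y≤m y≢m) (below y′≤m y′≢m) e

      Squarable : Pred A 0ℓ → Set
      Squarable D = InfiniteSet D → (D ⟨×⟩ D) ↪ D

      -- A ◁-initial segment of D × D lies in the square of some {y ≤ m}, which is
      -- too small to receive D.
      squarable-initial : ∀ (D : Pred A 0ℓ) → (∀ {m} → m ∈ D → ¬ D ↪ (_< m)) →
                          (∀ {m} → m ∈ D → Squarable (_< m)) → Squarable D
      squarable-initial D init sq inf =
        greedy ◁-isStrictTotalOrder ◁-wellFounded (to inf 0) λ {q} q∈D² D↪ →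
          absurd (max-∈ {D} q∈D²) (D↪ ⨾ ⊆⇒↪ λ (_ , p◁q) → ◁⇒≤max p◁q)
        where
        absurd : ∀ {m} → m ∈ D → ¬ D ↪ ((_≤ m) ⟨×⟩ (_≤ m))
        absurd {m} m∈D D↪ with lem {InfiniteSet (_< m)}
        -- Here `j` embeds `_≤ m` into `_< m`, whose square returns to `_< m`; so `D` would embed
        -- there as well.
        ... | yes i = init m∈D (D↪ ⨾ (j ⊗ j) ⨾ s)
          where
          s = sq m∈D i
          j = ≤↪<-square m i ⨾ s
        -- Here `_≤ m` is finite, and the infinite `D` would embed in its square.
        ... | no ¬i with n , k ← ¬InfiniteSet⇒bounded m ¬i =
          ¬InfiniteSet-square (ℕ.suc n) (inf ⨾ D↪ ⨾ (≤↪suc k ⊗ ≤↪suc k))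

      -- Well-founded induction. If the segment below `x` embeds in one below some `y < x`, the
      -- injection for `y` is transported; otherwise the segment satisfies the hypothesis of
      -- `squarable-initial`.
      squarable-< : ∀ x → Squarable (_< x)
      squarable-< = All.wfRec wf 0ℓ (λ x → Squarable (_< x)) step
        where
        step : ∀ x → WfRec _<_ (λ y → Squarable (_< y)) x → Squarable (_< x)
        step x ih inf with lem {∃ λ y → y < x × (_< x) ↪ (_< y)}
        ... | yes (y , y<x , k) =
          (k ⊗ k) ⨾ ih y<x (inf ⨾ k) ⨾ ⊆⇒↪ (λ z<y → <-trans z<y y<x)
        ... | no  ¬k =
          squarable-initial (_< x) (λ m<x k → ¬k (_ , m<x , k)) ih inf

    square↪ : ∀ Λ → Infinite Λ → (U {A = Carrier Λ} ⟨×⟩ U {A = Carrier Λ}) ↪ U {A = Carrier Λ}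
    square↪ Λ ℕ≼Λ = squarable-initial isStrictTotalOrder wellFounded U
      (λ {m} _ f → initial m record
        { to        = λ a → to f a , maps f a tt
        ; cong      = cong (to f)
        ; injective = injective f tt tt
        })
      (λ {m} _ → squarable-< isStrictTotalOrder wellFounded m)
      record
        { to        = Injection.to ℕ≼Λ
        ; maps      = _
        ; injective = λ _ _ → Injection.injective ℕ≼Λ
        }
      where open Cardinal Λ

  -- Colourings and cofinality

  -- Minimality of `γ` is used twice: on a cofinal class, and on the set of bounds that would be
  -- cofinal if no class were.
  largeClass : ∀ (σ γ κ : Cardinal) → γ IsCofinalityOf σ → ∣ κ ∣ ≺ ∣ γ ∣ → Carrier κ →
               (c : Carrier σ → Carrier κ) → ∃ λ k → ∣ γ ∣ ≼ ⟪ (λ s → c s ≡ k) ⟫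
  largeClass σ γ κ (_ , minimal) (_ , γ⋠κ) k₀ c = map id (minimal _) cofinalClass
    where
    open Cardinal σ using (isStrictTotalOrder; wellFounded) renaming (_≤_ to _≤σ_)

    cofinalClass : ∃ λ k → Cofinal σ (λ s → c s ≡ k)
    cofinalClass = byContradiction λ none →
      let
        bound : ∀ k → ∃ λ x → ∀ s → c s ≡ k → ¬ (x ≤σ s)
        bound k = byContradiction λ unbounded → none (k , λ x →
          byContradiction λ ¬s → unbounded (x , λ s s∈ x≤s → ¬s (s , s∈ , x≤s)))
        Source : Carrier σ → Pred (Carrier κ) 0ℓ
        Source x k = proj₁ (bound k) ≡ x
        bounds-cofinal : Cofinal σ (λ x → Satisfiable (Source x))
        -- The bound for the colour of `s` lies above `s`, which has that colour.
        bounds-cofinal s = _ , (c s , refl) ,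
          inj₁ (WellOrder.≰⇒> isStrictTotalOrder wellFounded (proj₂ (bound (c s)) s refl))
      in γ⋠κ (Compose.injection (minimal _ bounds-cofinal) record
        -- Each bound goes to a colour that it bounds, and `bound` undoes this; the default `k₀` is
        -- not reached.
        { to        = λ (x , _) → choose k₀ (Source x)
        ; cong      = λ { refl → refl }
        ; injective = λ { {_ , x∈} {_ , y∈} e →
            trans (sym (choose-∈ k₀ x∈)) (trans (cong (proj₁ ∘ bound) e) (choose-∈ k₀ y∈)) }
        })

-- The preimage is read off the membership proof; since `f` is injective, it does not depend on the
-- proof.
image≈ : {A B : Set} {P : Pred B 0ℓ} (f : setoid A ≼ ⟪ P ⟫) →
         ⟪ (λ y → ∃ λ a → proj₁ (Injection.to f a) ≡ y) ⟫ ≈ setoid A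
image≈ f = record
  { to        = proj₁ ∘ proj₂
  ; cong      = λ { {_ , _ , refl} {_ , _ , refl} → Injection.injective f }
  ; bijective = (λ { {_ , _ , refl} {_ , _ , refl} refl → refl })
              , λ a → (_ , a , refl) , λ { {_ , _ , refl} → Injection.injective f }
  }

-- Replacing sets by coloured graphs

module Graphs
  (lem : ExcludedMiddle 0ℓ) {I A K : Set} (𝓟 : Family I A)
  (e : ∀ i → ⟪ member 𝓟 i ⟫ ≼ setoid K)
  (π : (U {A = K} ⟨×⟩ U {A = A}) ↪ U {A = A})
  where

  colour : ∀ {i x} → x ∈ member 𝓟 i → K
  colour {i} {x} x∈ = Injection.to (e i) (x , x∈)

  colour-irrelevant : ∀ {i x y} {x∈ : x ∈ member 𝓟 i} {y∈ : y ∈ member 𝓟 i} →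
                      x ≡ y → colour x∈ ≡ colour y∈
  colour-irrelevant {i} = Injection.cong (e i)

  π-injective : ∀ {p q} → to π p ≡ to π q → p ≡ q
  π-injective = injective π _ _

  Graph : I → Pred A 0ℓ
  Graph i y = ∃ λ x → Σ (x ∈ member 𝓟 i) λ x∈ → to π (colour x∈ , x) ≡ y

  graphs : Family I A
  graphs = record
    { member   = Graph
    ; distinct = λ (⊆₁ , ⊆₂) → Family.distinct 𝓟 (domain ⊆₁ , domain ⊆₂)
    }
    where
    -- Since `π` is injective, a coded pair determines its second entry, so a graph determines the
    -- original set.
    domain : ∀ {i j} → Graph i ⊆ Graph j → member 𝓟 i ⊆ member 𝓟 j
    domain {j = j} sub x∈ with y , y∈ , eq ← sub (_ , x∈ , refl) =
      subst (_∈ member 𝓟 j) (cong proj₂ (π-injective eq)) y∈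

  -- The colour alone determines a point of the graph, because `e i` is injective.
  small : ∀ i → ⟪ Graph i ⟫ ≼ setoid K
  small i = record
    { to        = λ (_ , _ , x∈ , _) → colour x∈
    ; cong      = λ { {_ , _ , _ , refl} {_ , _ , _ , refl} eq → cong proj₁ (π-injective eq) }
    ; injective = λ { {_ , _ , _ , refl} {_ , _ , _ , refl} eq →
        cong (to π) (cong₂ _,_ eq (Injection.injective (e i) eq)) }
    }

  module _ {Q : Pred I 0ℓ} {f : I → A} (f-transversal : IsTransversal 𝓟 Q f) where
    private
      f∈ : ∀ {i} → i ∈ Q → f i ∈ member 𝓟 i
      f∈ = proj₁ f-transversal

    -- The second case is junk: it never applies to i ∈ Q.
    lift : I → A
    lift i with lem {f i ∈ member 𝓟 i}
    ... | yes x∈ = to π (colour x∈ , f i)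
    ... | no  _  = f i

    lift≡ : ∀ {i} (i∈Q : i ∈ Q) → lift i ≡ to π (colour (f∈ i∈Q) , f i)
    lift≡ {i} i∈Q with lem {f i ∈ member 𝓟 i}
    -- The membership proof from `lem` may differ from `f∈`, but has the same colour.
    ... | yes x∈ = cong (λ k → to π (k , f i)) (colour-irrelevant refl)
    ... | no  x∉ = contradiction (f∈ i∈Q) x∉

    lift-choice : IsChoiceOn graphs Q lift
    lift-choice i∈Q = _ , f∈ i∈Q , sym (lift≡ i∈Q)

    lift-transversal : IsTransversal graphs Q lift
    lift-transversal = lift-choice , λ i∈Q j∈Q eq →
      proj₂ f-transversal i∈Q j∈Q
        (cong proj₂ (π-injective (trans (sym (lift≡ i∈Q)) (trans eq (lift≡ j∈Q)))))

    -- If `lift i` lay in `Graph j`, then `f i` would belong to `member 𝓟 j` and have colour `k`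
    -- there, as `f j` does. Injectivity of `e j` would give `f i ≡ f j`, hence `i ≡ j`.
    lift-discretisation : ∀ {R : Pred I 0ℓ} k →
      (∀ {i} → i ∈ R → Σ (i ∈ Q) λ i∈Q → colour (f∈ i∈Q) ≡ k) →
      IsDiscretisation graphs R lift
    lift-discretisation {R} k mono = lift-choice ∘ proj₁ ∘ mono , disjoint
      where
      disjoint : ∀ {i j} → i ∈ R → j ∈ R → i ≢ j → ¬ Graph j (lift i)
      disjoint {i} {j} i∈R j∈R i≢j (x , x∈ , eq)
        with i∈Q , cᵢ ← mono i∈R | j∈Q , cⱼ ← mono j∈R
        with eq′ ← π-injective (trans eq (lift≡ i∈Q)) =
        i≢j (proj₂ f-transversal i∈Q j∈Q
          (trans (sym (cong proj₂ eq′))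
            (Injection.injective (e j)
              (trans (cong proj₁ eq′) (trans cᵢ (sym cⱼ))))))

-- The graph family and its discretisable subfamilies

theorem4p4 : (∀ {ℓ} → ExcludedMiddle ℓ) → (∀ {a b} → Extensionality a b) →
    (μ Λ θ κ : Cardinal) →
    Infinite μ → Infinite Λ → Infinite θ → Infinite κ →
    ∣ Λ ∣ ≺ ∣ μ ∣ → ∣ θ ∣ ≼ ∣ Λ ∣ → ∣ κ ∣ ≺ ∣ θ ∣ →
    (∃ λ (𝓟 : Family (Carrier μ) (Carrier Λ)) → IsTransversalFamily θ κ 𝓟) →
    ∃ λ (𝓟 : Family (Carrier μ) (Carrier Λ)) →
    IsTransversalFamily θ κ 𝓟 × HasDiscretisableSubfamilies θ κ 𝓟
theorem4p4 lem ext μ Λ θ κ _ ℕ≼Λ _ ℕ≼κ _ θ≼Λ (κ≼θ , _) (𝓟 , e , transversal) =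
  graphs , (small , λ Q Q≺θ → _ , lift-transversal (proj₂ (transversal Q Q≺θ))) , discretisable
  where
  κ≼Λ : ∣ κ ∣ ≼ ∣ Λ ∣
  κ≼Λ = Compose.injection κ≼θ θ≼Λ

  κ↪Λ : U {A = Carrier κ} ↪ U {A = Carrier Λ}
  κ↪Λ = record
    { to        = Injection.to κ≼Λ
    ; maps      = _
    ; injective = λ _ _ → Injection.injective κ≼Λ
    }

  -- The map `π` goes from κ × Λ through Λ × Λ to Λ.
  open Graphs lem 𝓟 e (κ↪Λ ⊗ ⊆⇒↪ id ⨾ square↪ lem ext Λ ℕ≼Λ)

  discretisable : HasDiscretisableSubfamilies θ κ graphs
  discretisable σ γ cof (σ≼θ , θ⋠σ) κ≺γ@(κ≼γ , _) Q Q≈σ =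
    R , proj₁ ∘ coloured , image≈ γ≼Q , (_ , point , refl) ,
    _ , lift-discretisation f-transversal (proj₁ class) coloured
    where
    Q≼σ : ⟪ Q ⟫ ≼ ∣ σ ∣
    Q≼σ = Bijection.injection Q≈σ

    σ≼Q : ∣ σ ∣ ≼ ⟪ Q ⟫
    σ≼Q = Bijection.injection (Symmetry.bijection-≡ Q≈σ)

    f-transversal : IsTransversal 𝓟 Q _
    f-transversal = proj₂ (transversal Q
      (Compose.injection Q≼σ σ≼θ , λ θ≼Q → θ⋠σ (Compose.injection θ≼Q Q≼σ)))

    -- The enumeration of `Q` by `σ` carries the colours over to `σ`, where cofinality makes sense.
    c : Carrier σ → Carrier κ
    c s = colour (proj₁ f-transversal (proj₂ (Injection.to σ≼Q s)))

    class : ∃ λ k → ∣ γ ∣ ≼ ⟪ (λ s → c s ≡ k) ⟫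
    class = largeClass lem σ γ κ cof κ≺γ (Injection.to ℕ≼κ 0) c

    γ≼Q : ∣ γ ∣ ≼ ⟪ Q ⟫
    γ≼Q = Compose.injection (proj₂ class)
            (Compose.injection record { to = proj₁ ; cong = id ; injective = id } σ≼Q)

    -- The image of `γ` in `Q`, running through a single colour class.
    R : Pred (Carrier μ) 0ℓ
    R i = ∃ λ g → proj₁ (Injection.to γ≼Q g) ≡ i

    coloured : ∀ {i} → i ∈ R → Σ (i ∈ Q) λ i∈Q → colour (proj₁ f-transversal i∈Q) ≡ proj₁ class
    coloured (g , refl) = proj₂ (Injection.to γ≼Q g) , proj₂ (Injection.to (proj₂ class) g)

    -- A witness that `R` is non-empty: the infinite `κ` embeds in `γ`.
    point : Carrier γ
    point = Injection.to κ≼γ (Injection.to ℕ≼κ 0)
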